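{- Let $N$ be a finite set with $|N|\geq 3$, and let $\mathcal{S}:=\mathcal{B}\cup\{M\}$ be a min-semi-balanced set system on $N$, where $\mathcal{B}$ is a min-balanced set system on $M\subset N$, $|M|\geq 2$. Then the following two conditions are equivalent: (i) $\mathcal{B}$ is irreducible; (ii) $\mathcal{S}$ is indecomposable.
   Context: $\mathcal{P}(N)$ is the power set of $N$, $\subset$ is strict inclusion, and $\chi_S$ is the incidence vector of $S$. A constant vector in $\mathbb{R}^N$ is a vector $[r,\ldots,r]$, $r\in\mathbb{R}$. A linear combination is conic if all coefficients are $\geq 0$, and semi-conic if at most one coefficient is strictly negative. For a finite set $K$ with $|K|\geq 2$, a non-trivial set system on $K$ is a system $\mathcal{S}$ with $\emptyset\neq\mathcal{S}\subseteq\mathcal{P}(K)\setminus\{\emptyset,K\}$. It is balanced on $K$ if $\chi_K$ is a conic combination of $\{\chi_S:S\in\mathcal{S}\}$ with all coefficients non-zero. It is semi-balanced on $K$ if some constant vector in $\mathbb{R}^K$ is a semi-conic combination of $\{\chi_S:S\in\mathcal{S}\}$ with all coefficients non-zero. It is min-balanced (min-semi-balanced) on $K$ if it is balanced (semi-balanced) on $K$ and has no strict subsystem that is balanced (semi-balanced) on $K$. It is purely min-semi-balanced if it is min-semi-balanced and not balanced. A set $T\in\mathcal{S}$ is exceptional within a non-trivial system $\mathcal{S}$ on $N$ if there is a linear combination $\sum_{S\in\mathcal{S}}\lambda_S\chi_S$ yielding a constant vector in $\mathbb{R}^N$ with $\lambda_T<0$ and $\lambda_S\geq 0$ for $S\in\mathcal{S}\setminus\{T\}$.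 A purely min-semi-balanced system $\mathcal{S}$ on $N$ is indecomposable if there is no $E\subseteq N$ with $E\notin\mathcal{S}\cup\{\emptyset,N\}$ such that $E$ is exceptional within $\mathcal{S}\cup\{E\}$. A min-balanced system $\mathcal{B}$ on $M$ is reducible if there exists $\emptyset\neq E\subset M$ such that $\chi_E$ is a conic combination of $\{\chi_S:S\in\mathcal{B},\ S\subset E\}$; otherwise it is irreducible. -}

module Defs where

open import Algebra.Bundles using (CommutativeRing)
open import Data.Bool.Base using (Bool; true; false; _∧_; _∨_; if_then_else_)
import Data.Bool.Properties as Bool
open import Data.Fin.Base using (Fin)
open import Data.Fin.Subset
  using (Subset; inside; outside; ⊤; ⊥; _∈_; _⊆_; _⊂_; ∣_∣)
open import Data.Fin.Subset.Properties using (_⊂?_)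
open import Data.Nat.Base as ℕ using (ℕ; zero; suc)
open import Data.Product.Base using (∃-syntax; _×_)
open import Data.Vec.Base using ([]; _∷_; lookup)
open import Data.Vec.Properties using (≡-dec)
open import Level using (_⊔_) renaming (suc to lsuc)
open import Relation.Binary.Construct.NonStrictToStrict as Strict using ()
open import Relation.Binary.Core using (Rel)
open import Relation.Binary.Definitions using (DecidableEquality)
open import Relation.Binary.PropositionalEquality.Core using (_≡_; _≢_)
open import Relation.Binary.Structures using (IsTotalOrder)
open import Relation.Nullary using (¬_; ⌊_⌋)

-- The scalars.  The library has no real numbers, so they range over an
-- arbitrary (linearly) ordered field, of which ℝ is classically an instance.
record OrderedField c ℓ₁ ℓ₂ : Set (lsuc (c ⊔ ℓ₁ ⊔ ℓ₂)) where
  infix 4 _≤_ _<_ _≉_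
  field
    commutativeRing : CommutativeRing c ℓ₁

  open CommutativeRing commutativeRing public hiding (_≉_)

  _≉_ : Rel Carrier ℓ₁
  x ≉ y = ¬ (x ≈ y)

  field
    0≉1          : 0# ≉ 1#
    inverse      : ∀ {x} → x ≉ 0# → ∃[ y ] x * y ≈ 1#
    _≤_          : Rel Carrier ℓ₂
    isTotalOrder : IsTotalOrder _≈_ _≤_
    +-monoˡ-≤    : ∀ z {x y} → x ≤ y → x + z ≤ y + z
    *-nonneg     : ∀ {x y} → 0# ≤ x → 0# ≤ y → 0# ≤ x * y

  _<_ : Rel Carrier (ℓ₁ ⊔ ℓ₂)
  _<_ = Strict._<_ _≈_ _≤_

infix 4 _≟ˢ_

_≟ˢ_ : ∀ {n} → DecidableEquality (Subset n)
_≟ˢ_ = ≡-dec Bool._≟_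

-- The ambient finite set N is Fin n.  A finite set K ⊆ N and a system of
-- subsets of it are represented by  K : Subset n  and  𝒮 : SetSystem n.
SetSystem : ℕ → Set
SetSystem n = Subset n → Bool

module _ {n : ℕ} where

  infix 4 _∈ˢ_ _⊆ˢ_ _⊂ˢ_
  infixl 6 _∪｛_｝

  _∈ˢ_ : Subset n → SetSystem n → Set
  S ∈ˢ 𝒮 = 𝒮 S ≡ true

  _⊆ˢ_ : SetSystem n → SetSystem n → Set
  𝒯 ⊆ˢ 𝒮 = ∀ {S} → S ∈ˢ 𝒯 → S ∈ˢ 𝒮

  _⊂ˢ_ : SetSystem n → SetSystem n → Set
  𝒯 ⊂ˢ 𝒮 = 𝒯 ⊆ˢ 𝒮 × ∃[ S ] (S ∈ˢ 𝒮 × ¬ (S ∈ˢ 𝒯))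

  _∪｛_｝ : SetSystem n → Subset n → SetSystem n
  (𝒮 ∪｛ T ｝) S = 𝒮 S ∨ ⌊ S ≟ˢ T ⌋

  strictlyBelow : SetSystem n → Subset n → SetSystem n
  strictlyBelow 𝒮 E S = 𝒮 S ∧ ⌊ S ⊂? E ⌋

  record NonTrivial (K : Subset n) (𝒮 : SetSystem n) : Set where
    field
      size      : 2 ℕ.≤ ∣ K ∣
      nonempty  : ∃[ S ] S ∈ˢ 𝒮
      members⊆K : ∀ {S} → S ∈ˢ 𝒮 → S ⊆ K
      members≢∅ : ∀ {S} → S ∈ˢ 𝒮 → S ≢ ⊥
      members≢K : ∀ {S} → S ∈ˢ 𝒮 → S ≢ K

module SetSystems {c ℓ₁ ℓ₂} (F : OrderedField c ℓ₁ ℓ₂) where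

  open OrderedField F

  sumSubsets : ∀ {n} → (Subset n → Carrier) → Carrier
  sumSubsets {zero}  f = f []
  sumSubsets {suc n} f =
    sumSubsets (λ S → f (outside ∷ S)) + sumSubsets (λ S → f (inside ∷ S))

  module _ {n : ℕ} where

    infix 4 _≈[_]_

    χ : Subset n → Fin n → Carrier
    χ S i = if lookup S i then 1# else 0#

    -- Values of a coefficient family outside the system are irrelevant, here
    -- and in the three predicates on coefficients below.
    combination : SetSystem n → (Subset n → Carrier) → Fin n → Carrier
    combination 𝒮 coeff i =
      sumSubsets (λ S → if 𝒮 S then coeff S * χ S i else 0#)

    -- Equality in the space of vectors indexed by K: coordinates outside K
    -- are ignored.
    _≈[_]_ : (Fin n → Carrier) → Subset n → (Fin n → Carrier) → Set ℓ₁
    v ≈[ K ] w = ∀ {i} → i ∈ K → v i ≈ w i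

    ConstantOn : Subset n → (Fin n → Carrier) → Set (c ⊔ ℓ₁)
    ConstantOn K v = ∃[ r ] v ≈[ K ] (λ _ → r)

    Conic : SetSystem n → (Subset n → Carrier) → Set ℓ₂
    Conic 𝒮 coeff = ∀ {S} → S ∈ˢ 𝒮 → 0# ≤ coeff S

    SemiConic : SetSystem n → (Subset n → Carrier) → Set (ℓ₁ ⊔ ℓ₂)
    SemiConic 𝒮 coeff =
      ∀ {S T} → S ∈ˢ 𝒮 → T ∈ˢ 𝒮 → coeff S < 0# → coeff T < 0# → S ≡ T

    AllNonZero : SetSystem n → (Subset n → Carrier) → Set ℓ₁
    AllNonZero 𝒮 coeff = ∀ {S} → S ∈ˢ 𝒮 → coeff S ≉ 0#

    Balanced : Subset n → SetSystem n → Set (c ⊔ ℓ₁ ⊔ ℓ₂)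
    Balanced K 𝒮 =
      NonTrivial K 𝒮 ×
      ∃[ coeff ] (Conic 𝒮 coeff × AllNonZero 𝒮 coeff ×
                  combination 𝒮 coeff ≈[ K ] χ K)

    SemiBalanced : Subset n → SetSystem n → Set (c ⊔ ℓ₁ ⊔ ℓ₂)
    SemiBalanced K 𝒮 =
      NonTrivial K 𝒮 ×
      ∃[ coeff ] (SemiConic 𝒮 coeff × AllNonZero 𝒮 coeff ×
                  ConstantOn K (combination 𝒮 coeff))

    MinBalanced : Subset n → SetSystem n → Set (c ⊔ ℓ₁ ⊔ ℓ₂)
    MinBalanced K 𝒮 = Balanced K 𝒮 × (∀ 𝒯 → 𝒯 ⊂ˢ 𝒮 → ¬ Balanced K 𝒯)

    MinSemiBalanced : Subset n → SetSystem n → Set (c ⊔ ℓ₁ ⊔ ℓ₂)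
    MinSemiBalanced K 𝒮 =
      SemiBalanced K 𝒮 × (∀ 𝒯 → 𝒯 ⊂ˢ 𝒮 → ¬ SemiBalanced K 𝒯)

    PurelyMinSemiBalanced : Subset n → SetSystem n → Set (c ⊔ ℓ₁ ⊔ ℓ₂)
    PurelyMinSemiBalanced K 𝒮 = MinSemiBalanced K 𝒮 × ¬ Balanced K 𝒮

    record Exceptional (T : Subset n) (𝒮 : SetSystem n)
                       : Set (c ⊔ ℓ₁ ⊔ ℓ₂) where
      field
        nonTrivial : NonTrivial ⊤ 𝒮
        member     : T ∈ˢ 𝒮
        coeff      : Subset n → Carrier
        constant   : ConstantOn ⊤ (combination 𝒮 coeff)
        negative   : coeff T < 0#
        nonneg     : ∀ {S} → S ∈ˢ 𝒮 → S ≢ T → 0# ≤ coeff S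

    -- Indecomposability is defined for purely min-semi-balanced systems only,
    -- and irreducibility for min-balanced ones; both domains are built in.
    Indecomposable : SetSystem n → Set (c ⊔ ℓ₁ ⊔ ℓ₂)
    Indecomposable 𝒮 =
      PurelyMinSemiBalanced ⊤ 𝒮 ×
      ¬ (∃[ E ] (¬ (E ∈ˢ 𝒮) × E ≢ ⊥ × E ≢ ⊤ × Exceptional E (𝒮 ∪｛ E ｝)))

    Reducible : Subset n → SetSystem n → Set (c ⊔ ℓ₁ ⊔ ℓ₂)
    Reducible M ℬ =
      ∃[ E ] (E ≢ ⊥ × E ⊂ M ×
        ∃[ coeff ] (Conic (strictlyBelow ℬ E) coeff ×
                    combination (strictlyBelow ℬ E) coeff ≈[ M ] χ E))

    Irreducible : Subset n → SetSystem n → Set (c ⊔ ℓ₁ ⊔ ℓ₂)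
    Irreducible M ℬ = MinBalanced M ℬ × ¬ Reducible M ℬ

{-# OPTIONS --safe #-}

-- All members of ℬ ∪ {M} lie in M ≠ N, so a coordinate outside M carries no
-- weight.  Suppose λ_E < 0 and the other coefficients are non-negative in a
-- combination of ℬ ∪ {M, E} with constant value r.  Reading it outside M and
-- outside E forces r = 0 and E ⊂ M, so |λ_E| χ_E is a conic combination of
-- ℬ ∪ {M}; at coordinates outside E the non-negative terms sum to zero, so only
-- sets strictly inside E contribute, and ℬ is reducible.  Conversely, a
-- conic representation of χ_E by sets strictly inside E, minus χ_E itself,
-- makes E exceptional; E is not in ℬ because otherwise it could be eliminated
-- from the balancing combination of ℬ, contradicting minimality.
module Submission where

open import Defs
import Algebra.Properties.CommutativeSemigroup as CommutativeSemigroupProperties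
import Algebra.Properties.Ring as RingProperties
open import Data.Bool.Base using (true; false; _∧_; not; if_then_else_)
import Data.Bool.Properties as Bool
open import Data.Empty using (⊥-elim)
open import Data.Fin.Base using (Fin)
import Data.Fin.Properties as Fin
open import Data.Fin.Subset
  using (Subset; ⊤; _⊂_; ∣_∣; inside; outside; ⊥; _∈_; _∉_; _⊆_; _⊈_; Nonempty)
open import Data.Fin.Subset.Properties
  using (_∈?_; _⊂?_; ⊆-antisym; ⊂-irref; ⊂-asymmetric; ⊆⊤; ∈⊤;
         nonempty?; Empty-unique; anySubset?)
open import Data.Nat.Base using (ℕ; _≤_)
open import Data.Product.Base using (∃-syntax; _×_; _,_; proj₁; proj₂)
open import Data.Sum.Base using (_⊎_; inj₁; inj₂)
open import Data.Vec.Base using ([]; _∷_; lookup)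
open import Data.Vec.Properties using ([]=⇒lookup; lookup⇒[]=)
open import Function.Base using (_∘_)
open import Function.Bundles using (_⇔_; mk⇔)
import Relation.Binary.Reasoning.Setoid as SetoidReasoning
import Relation.Binary.PropositionalEquality as ≡
open import Relation.Binary.PropositionalEquality using (_≡_; _≢_; refl)
open import Relation.Binary.Structures using (IsTotalOrder)
open import Relation.Nullary using (¬_; Dec; yes; no; contradiction; ⌊_⌋)
open import Relation.Nullary.Decidable using (decidable-stable; ¬?; _×-dec_)

-- Finite subsets and set systems.

module _ {n : ℕ} where

  -- Coordinates can be searched exhaustively and membership is decidable, so a failed inclusion
  -- yields an explicit counterexample.
  ⊈⇒∃∉ : {p q : Subset n} → p ⊈ q → ∃[ x ] (x ∈ p × x ∉ q)
  ⊈⇒∃∉ {p} {q} p⊈q with Fin.any? (λ x → x ∈? p ×-dec ¬? (x ∈? q))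
  ... | yes found = found
  ... | no none   = contradiction
    (λ {x} x∈p → decidable-stable (x ∈? q) (λ x∉q → none (x , x∈p , x∉q))) p⊈q

  ⊆∧≢⇒⊂ : {p q : Subset n} → p ⊆ q → p ≢ q → p ⊂ q
  ⊆∧≢⇒⊂ p⊆q p≢q = p⊆q , ⊈⇒∃∉ (p≢q ∘ ⊆-antisym p⊆q)

  ≢⊤⇒∃∉ : {p : Subset n} → p ≢ ⊤ → ∃[ x ] x ∉ p
  ≢⊤⇒∃∉ p≢⊤ = let x , _ , x∉p = ⊈⇒∃∉ (p≢⊤ ∘ ⊆-antisym ⊆⊤) in x , x∉p

  ≢⊥⇒Nonempty : {p : Subset n} → p ≢ ⊥ → Nonempty p
  ≢⊥⇒Nonempty {p} p≢⊥ = decidable-stable (nonempty? p) (p≢⊥ ∘ Empty-unique)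

  infixl 6 _∖｛_｝

  _∖｛_｝ : SetSystem n → Subset n → SetSystem n
  (𝒮 ∖｛ T ｝) S = 𝒮 S ∧ not ⌊ S ≟ˢ T ⌋

  module _ (𝒮 : SetSystem n) {S T : Subset n} where

    ∈-∪⁺ˡ : S ∈ˢ 𝒮 → S ∈ˢ 𝒮 ∪｛ T ｝
    ∈-∪⁺ˡ S∈𝒮 rewrite S∈𝒮 = refl

    ∈-∪⁺ʳ : S ≡ T → S ∈ˢ 𝒮 ∪｛ T ｝
    ∈-∪⁺ʳ S≡T with 𝒮 S | S ≟ˢ T
    ... | true  | _       = refl
    ... | false | yes _   = refl
    ... | false | no S≢T  = contradiction S≡T S≢T

    ∈-∪⁻ : S ∈ˢ 𝒮 ∪｛ T ｝ → S ∈ˢ 𝒮 ⊎ S ≡ T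
    ∈-∪⁻ S∈ with 𝒮 S | S ≟ˢ T
    ... | true  | _       = inj₁ refl
    ... | false | yes S≡T = inj₂ S≡T

    ∈-∖⁺ : S ∈ˢ 𝒮 → S ≢ T → S ∈ˢ 𝒮 ∖｛ T ｝
    ∈-∖⁺ S∈𝒮 S≢T rewrite S∈𝒮 with S ≟ˢ T
    ... | yes S≡T = contradiction S≡T S≢T
    ... | no _    = refl

    ∈-∖⁻ : S ∈ˢ 𝒮 ∖｛ T ｝ → S ∈ˢ 𝒮 × S ≢ T
    ∈-∖⁻ S∈ with 𝒮 S | S ≟ˢ T
    ... | true | no S≢T = refl , S≢T

    ∈-below⁺ : S ∈ˢ 𝒮 → S ⊂ T → S ∈ˢ strictlyBelow 𝒮 T
    ∈-below⁺ S∈𝒮 S⊂T rewrite S∈𝒮 with S ⊂? T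
    ... | yes _   = refl
    ... | no S⊄T  = contradiction S⊂T S⊄T

    ∈-below⁻ : S ∈ˢ strictlyBelow 𝒮 T → S ∈ˢ 𝒮 × S ⊂ T
    ∈-below⁻ S∈ with 𝒮 S | S ⊂? T
    ... | true | yes S⊂T = refl , S⊂T

  NonTrivial-∪ : {𝒮 : SetSystem n} {K E : Subset n} → NonTrivial K 𝒮 →
                 E ⊆ K → E ≢ ⊥ → E ≢ K → NonTrivial K (𝒮 ∪｛ E ｝)
  NonTrivial-∪ {𝒮} {K} {E} nt E⊆K E≢⊥ E≢K = record
    { size      = size
    ; nonempty  = E , ∈-∪⁺ʳ 𝒮 refl
    ; members⊆K = λ S∈ {x} x∈S → sub (∈-∪⁻ 𝒮 S∈) x∈S
    ; members≢∅ = λ S∈ → extend {_≢ ⊥} members≢∅ E≢⊥ (∈-∪⁻ 𝒮 S∈)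
    ; members≢K = λ S∈ → extend {_≢ K} members≢K E≢K (∈-∪⁻ 𝒮 S∈)
    }
    where
    open NonTrivial nt
    extend : {P : Subset n → Set} → (∀ {S} → S ∈ˢ 𝒮 → P S) → P E →
             ∀ {S} → S ∈ˢ 𝒮 ⊎ S ≡ E → P S
    extend P𝒮 PE (inj₁ S∈𝒮)  = P𝒮 S∈𝒮
    extend P𝒮 PE (inj₂ refl) = PE
    sub : ∀ {S} → S ∈ˢ 𝒮 ⊎ S ≡ E → S ⊆ K
    sub (inj₁ S∈𝒮)  = members⊆K S∈𝒮
    sub (inj₂ refl) = E⊆K

  NonTrivial-⊆ : {𝒮 𝒯 : SetSystem n} {K : Subset n} → NonTrivial K 𝒮 →
                 𝒯 ⊆ˢ 𝒮 → ∃[ S ] S ∈ˢ 𝒯 → NonTrivial K 𝒯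
  NonTrivial-⊆ nt 𝒯⊆𝒮 inhabited = record
    { size      = size
    ; nonempty  = inhabited
    ; members⊆K = members⊆K ∘ 𝒯⊆𝒮
    ; members≢∅ = members≢∅ ∘ 𝒯⊆𝒮
    ; members≢K = members≢K ∘ 𝒯⊆𝒮
    }
    where open NonTrivial nt

-- Order arithmetic in an ordered field.

module OrderedFieldProperties {c ℓ₁ ℓ₂} (F : OrderedField c ℓ₁ ℓ₂) where

  open OrderedField F hiding (refl) renaming (_≤_ to _≤ᶠ_)
  open RingProperties ring
  open IsTotalOrder isTotalOrder
    using (antisym; total; ≤-respˡ-≈; ≤-respʳ-≈)
    renaming (trans to ≤-trans; refl to ≤-refl) public

  +-nonneg : ∀ {x y} → 0# ≤ᶠ x → 0# ≤ᶠ y → 0# ≤ᶠ x + y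
  +-nonneg {x} {y} 0≤x 0≤y =
    ≤-trans 0≤y (≤-respˡ-≈ (+-identityˡ y) (+-monoˡ-≤ y 0≤x))

  -- Adding `y` to `0# ≤ x` gives `y ≤ x + y ≈ 0#`, and antisymmetry concludes.
  x+y≈0⇒y≈0 : ∀ {x y} → 0# ≤ᶠ x → 0# ≤ᶠ y → x + y ≈ 0# → y ≈ 0#
  x+y≈0⇒y≈0 {x} {y} 0≤x 0≤y x+y≈0 =
    antisym (≤-respʳ-≈ x+y≈0 (≤-respˡ-≈ (+-identityˡ y) (+-monoˡ-≤ y 0≤x))) 0≤y

  x+y≈0⇒x≈0 : ∀ {x y} → 0# ≤ᶠ x → 0# ≤ᶠ y → x + y ≈ 0# → x ≈ 0#
  x+y≈0⇒x≈0 {x} {y} 0≤x 0≤y x+y≈0 =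
    x+y≈0⇒y≈0 0≤y 0≤x (trans (+-comm y x) x+y≈0)

  -‿nonneg : ∀ {x} → x ≤ᶠ 0# → 0# ≤ᶠ - x
  -‿nonneg {x} x≤0 =
    ≤-respˡ-≈ (-‿inverseʳ x) (≤-respʳ-≈ (+-identityˡ (- x)) (+-monoˡ-≤ (- x) x≤0))

  -1*-1≈1 : - 1# * - 1# ≈ 1#
  -1*-1≈1 = trans (-1*x≈-x (- 1#)) (-‿involutive 1#)

  -- If instead `1# ≤ 0#`, then `- 1#` is non-negative and `1#` is its square.
  0≤1 : 0# ≤ᶠ 1#
  0≤1 with total 0# 1#
  ... | inj₁ 0≤1 = 0≤1
  ... | inj₂ 1≤0 = ≤-respʳ-≈ -1*-1≈1 (*-nonneg (-‿nonneg 1≤0) (-‿nonneg 1≤0))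

  -1<0 : - 1# < 0#
  -1<0 = -1≤0 , λ -1≈0 → 0≉1 (sym (trans (sym (+-identityʳ 1#))
           (trans (+-congˡ (sym -1≈0)) (-‿inverseʳ 1#))))
    where
    -1≤0 : - 1# ≤ᶠ 0#
    -1≤0 = ≤-respˡ-≈ (+-identityˡ (- 1#))
             (≤-respʳ-≈ (-‿inverseʳ 1#) (+-monoˡ-≤ (- 1#) 0≤1))

  -- A non-positive `y` would make `x * - y ≈ - 1#` non-negative, and then `0#` and `1#` would
  -- coincide.
  inverse-nonneg : ∀ {x y} → 0# ≤ᶠ x → x * y ≈ 1# → 0# ≤ᶠ y
  inverse-nonneg {x} {y} 0≤x xy≈1 with total 0# y
  ... | inj₁ 0≤y = 0≤y
  ... | inj₂ y≤0 = contradiction (antisym 0≤1 1≤0) 0≉1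
    where
    0≤-1 : 0# ≤ᶠ - 1#
    0≤-1 = ≤-respʳ-≈ (trans (sym (-‿distribʳ-* x y)) (-‿cong xy≈1))
             (*-nonneg 0≤x (-‿nonneg y≤0))
    1≤0 : 1# ≤ᶠ 0#
    1≤0 = ≤-respˡ-≈ (+-identityˡ 1#)
            (≤-respʳ-≈ (-‿inverseˡ 1#) (+-monoˡ-≤ 1# 0≤-1))

-- Sums indexed by all subsets.

module Combinations {c ℓ₁ ℓ₂} (F : OrderedField c ℓ₁ ℓ₂) where

  open OrderedField F hiding (refl) renaming (_≤_ to _≤ᶠ_)
  open OrderedFieldProperties F
  open RingProperties ring
  open SetSystems F
  open SetoidReasoning setoid
  open CommutativeSemigroupProperties +-commutativeSemigroup using (interchange)

  ≈-refl : ∀ {x} → x ≈ x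
  ≈-refl = OrderedField.refl F

  sumSubsets-cong : ∀ {n} {f g : Subset n → Carrier} →
                    (∀ S → f S ≈ g S) → sumSubsets f ≈ sumSubsets g
  sumSubsets-cong {ℕ.zero}  f≈g = f≈g []
  sumSubsets-cong {ℕ.suc n} f≈g =
    +-cong (sumSubsets-cong (λ S → f≈g (outside ∷ S)))
           (sumSubsets-cong (λ S → f≈g (inside ∷ S)))

  sumSubsets-+ : ∀ {n} (f g : Subset n → Carrier) →
                 sumSubsets (λ S → f S + g S) ≈ sumSubsets f + sumSubsets g
  sumSubsets-+ {ℕ.zero}  f g = ≈-refl
  sumSubsets-+ {ℕ.suc n} f g =
    trans (+-cong (sumSubsets-+ {n} _ _) (sumSubsets-+ {n} _ _)) (interchange _ _ _ _)

  sumSubsets-*ˡ : ∀ {n} k (f : Subset n → Carrier) →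
                  sumSubsets (λ S → k * f S) ≈ k * sumSubsets f
  sumSubsets-*ˡ {ℕ.zero}  k f = ≈-refl
  sumSubsets-*ˡ {ℕ.suc n} k f =
    trans (+-cong (sumSubsets-*ˡ {n} k _) (sumSubsets-*ˡ {n} k _)) (sym (distribˡ k _ _))

  sumSubsets-zero : ∀ {n} {f : Subset n → Carrier} →
                    (∀ S → f S ≈ 0#) → sumSubsets f ≈ 0#
  sumSubsets-zero {ℕ.zero}  f≈0 = f≈0 []
  sumSubsets-zero {ℕ.suc n} f≈0 =
    trans (+-cong (sumSubsets-zero (λ S → f≈0 (outside ∷ S)))
                  (sumSubsets-zero (λ S → f≈0 (inside ∷ S))))
          (+-identityʳ 0#)

  sumSubsets-single : ∀ {n} (f : Subset n → Carrier) T →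
                      (∀ S → S ≢ T → f S ≈ 0#) → sumSubsets f ≈ f T
  sumSubsets-single f []            f≈0 = ≈-refl
  sumSubsets-single f (outside ∷ T) f≈0 =
    trans (+-cong (sumSubsets-single _ T (λ S S≢T → f≈0 (outside ∷ S) λ { refl → S≢T refl }))
                  (sumSubsets-zero (λ S → f≈0 (inside ∷ S) λ ())))
          (+-identityʳ _)
  sumSubsets-single f (inside ∷ T)  f≈0 =
    trans (+-cong (sumSubsets-zero (λ S → f≈0 (outside ∷ S) λ ()))
                  (sumSubsets-single _ T (λ S S≢T → f≈0 (inside ∷ S) λ { refl → S≢T refl })))
          (+-identityˡ _)

  sumSubsets-nonneg : ∀ {n} {f : Subset n → Carrier} →
                      (∀ S → 0# ≤ᶠ f S) → 0# ≤ᶠ sumSubsets f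
  sumSubsets-nonneg {ℕ.zero}  0≤f = 0≤f []
  sumSubsets-nonneg {ℕ.suc n} 0≤f =
    +-nonneg (sumSubsets-nonneg (λ S → 0≤f (outside ∷ S)))
             (sumSubsets-nonneg (λ S → 0≤f (inside ∷ S)))

  -- Both halves of the sum are non-negative, so both vanish, and the induction descends into the
  -- half containing `S`.
  sumSubsets≈0⇒≈0 : ∀ {n} {f : Subset n → Carrier} → (∀ S → 0# ≤ᶠ f S) →
                    sumSubsets f ≈ 0# → ∀ S → f S ≈ 0#
  sumSubsets≈0⇒≈0 0≤f Σ≈0 []            = Σ≈0
  sumSubsets≈0⇒≈0 0≤f Σ≈0 (outside ∷ S) =
    sumSubsets≈0⇒≈0 (λ S → 0≤f (outside ∷ S))
      (x+y≈0⇒x≈0 (sumSubsets-nonneg (λ S → 0≤f (outside ∷ S)))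
                 (sumSubsets-nonneg (λ S → 0≤f (inside ∷ S))) Σ≈0) S
  sumSubsets≈0⇒≈0 0≤f Σ≈0 (inside ∷ S)  =
    sumSubsets≈0⇒≈0 (λ S → 0≤f (inside ∷ S))
      (x+y≈0⇒y≈0 (sumSubsets-nonneg (λ S → 0≤f (outside ∷ S)))
                 (sumSubsets-nonneg (λ S → 0≤f (inside ∷ S))) Σ≈0) S

  -- Incidence vectors and their linear combinations.

  module _ {n : ℕ} where

    χ-∈ : {S : Subset n} {i : Fin n} → i ∈ S → χ S i ≈ 1#
    χ-∈ i∈S rewrite []=⇒lookup i∈S = ≈-refl

    χ-∉ : {S : Subset n} {i : Fin n} → i ∉ S → χ S i ≈ 0#
    χ-∉ {S} {i} i∉S with lookup S i in eq
    ... | true  = contradiction (lookup⇒[]= i S eq) i∉S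
    ... | false = ≈-refl

    χ-nonneg : (S : Subset n) (i : Fin n) → 0# ≤ᶠ χ S i
    χ-nonneg S i with lookup S i
    ... | true  = 0≤1
    ... | false = ≤-refl

    *χ-∈ : ∀ {S : Subset n} {i} x → i ∈ S → x * χ S i ≈ x
    *χ-∈ x i∈S = trans (*-congˡ (χ-∈ i∈S)) (*-identityʳ x)

    *χ-∉ : ∀ {S : Subset n} {i} x → i ∉ S → x * χ S i ≈ 0#
    *χ-∉ x i∉S = trans (*-congˡ (χ-∉ i∉S)) (zeroʳ x)

    module _ (𝒮 : SetSystem n) where

      combination-zero : ∀ {coeff i} → (∀ {S} → S ∈ˢ 𝒮 → coeff S * χ S i ≈ 0#) →
                         combination 𝒮 coeff i ≈ 0#
      combination-zero {coeff} {i} vanish = sumSubsets-zero term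
        where
        term : ∀ S → (if 𝒮 S then coeff S * χ S i else 0#) ≈ 0#
        term S with 𝒮 S in eq
        ... | true  = vanish eq
        ... | false = ≈-refl

      combination-∉ : ∀ {coeff i} → (∀ {S} → S ∈ˢ 𝒮 → i ∉ S) →
                      combination 𝒮 coeff i ≈ 0#
      combination-∉ i∉ = combination-zero (λ S∈𝒮 → *χ-∉ _ (i∉ S∈𝒮))

      -- There are finitely many subsets, so having a member is decidable and refuting emptiness
      -- produces one.
      combination≉0⇒nonempty : ∀ {coeff i} → combination 𝒮 coeff i ≉ 0# →
                               ∃[ S ] S ∈ˢ 𝒮
      combination≉0⇒nonempty Σ≉0 =
        decidable-stable (anySubset? (λ S → 𝒮 S Bool.≟ true))
          (λ none → Σ≉0 (combination-zero (λ S∈𝒮 → ⊥-elim (none (_ , S∈𝒮)))))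

      term-nonneg : ∀ {coeff} → Conic 𝒮 coeff → ∀ i S →
                    0# ≤ᶠ (if 𝒮 S then coeff S * χ S i else 0#)
      term-nonneg conic i S with 𝒮 S in eq
      ... | true  = *-nonneg (conic eq) (χ-nonneg S i)
      ... | false = ≤-refl

      combination-nonneg : ∀ {coeff} → Conic 𝒮 coeff → ∀ i →
                           0# ≤ᶠ combination 𝒮 coeff i
      combination-nonneg conic i = sumSubsets-nonneg (term-nonneg conic i)

      -- All terms at `i` are non-negative with zero sum, hence zero, and the term of a set
      -- containing `i` is its coefficient.
      combination≈0⇒coeff≈0 : ∀ {coeff i} → Conic 𝒮 coeff →
                              combination 𝒮 coeff i ≈ 0# →
                              ∀ {S} → S ∈ˢ 𝒮 → i ∈ S → coeff S ≈ 0#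
      combination≈0⇒coeff≈0 {coeff} {i} conic Σ≈0 {S} S∈𝒮 i∈S =
        trans (sym (*χ-∈ (coeff S) i∈S)) (trans (sym term) term≈0)
        where
        term≈0 : (if 𝒮 S then coeff S * χ S i else 0#) ≈ 0#
        term≈0 = sumSubsets≈0⇒≈0 (term-nonneg conic i) Σ≈0 S
        term : (if 𝒮 S then coeff S * χ S i else 0#) ≈ coeff S * χ S i
        term rewrite S∈𝒮 = ≈-refl

      combination-* : ∀ k coeff i →
        combination 𝒮 (λ S → k * coeff S) i ≈ k * combination 𝒮 coeff i
      combination-* k coeff i = trans (sumSubsets-cong term) (sumSubsets-*ˡ {n} k _)
        where
        term : ∀ S → (if 𝒮 S then (k * coeff S) * χ S i else 0#) ≈
                     k * (if 𝒮 S then coeff S * χ S i else 0#)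
        term S with 𝒮 S
        ... | true  = *-assoc k _ _
        ... | false = sym (zeroʳ k)

      combination-+ : ∀ coeff₁ coeff₂ i →
        combination 𝒮 (λ S → coeff₁ S + coeff₂ S) i ≈
        combination 𝒮 coeff₁ i + combination 𝒮 coeff₂ i
      combination-+ coeff₁ coeff₂ i =
        trans (sumSubsets-cong term) (sumSubsets-+ {n} _ _)
        where
        term : ∀ S → (if 𝒮 S then (coeff₁ S + coeff₂ S) * χ S i else 0#) ≈
                     (if 𝒮 S then coeff₁ S * χ S i else 0#) +
                     (if 𝒮 S then coeff₂ S * χ S i else 0#)
        term S with 𝒮 S
        ... | true  = distribʳ _ _ _
        ... | false = sym (+-identityʳ 0#)

      -- The indicator of the union is the sum of the two indicators because `T` is new; otherwise
      -- its term would be counted twice.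
      combination-∪ : ∀ {T} → ¬ (T ∈ˢ 𝒮) → ∀ coeff i →
        combination (𝒮 ∪｛ T ｝) coeff i ≈ combination 𝒮 coeff i + coeff T * χ T i
      combination-∪ {T} T∉𝒮 coeff i = begin
        combination (𝒮 ∪｛ T ｝) coeff i              ≈⟨ sumSubsets-cong term ⟩
        sumSubsets (λ S → (if 𝒮 S then coeff S * χ S i else 0#) + single S)
                                                      ≈⟨ sumSubsets-+ {n} _ _ ⟩
        combination 𝒮 coeff i + sumSubsets single     ≈⟨ +-congˡ (sumSubsets-single single T off) ⟩
        combination 𝒮 coeff i + single T              ≈⟨ +-congˡ on ⟩
        combination 𝒮 coeff i + coeff T * χ T i       ∎
        where
        single : Subset n → Carrier
        single S = if ⌊ S ≟ˢ T ⌋ then coeff S * χ S i else 0#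
        off : ∀ S → S ≢ T → single S ≈ 0#
        off S S≢T with S ≟ˢ T
        ... | yes S≡T = contradiction S≡T S≢T
        ... | no _    = ≈-refl
        on : single T ≈ coeff T * χ T i
        on with T ≟ˢ T
        ... | yes _  = ≈-refl
        ... | no T≢T = contradiction refl T≢T
        term : ∀ S → (if (𝒮 ∪｛ T ｝) S then coeff S * χ S i else 0#) ≈
                     (if 𝒮 S then coeff S * χ S i else 0#) + single S
        term S with 𝒮 S in eq | S ≟ˢ T
        ... | true  | yes refl = contradiction eq T∉𝒮
        ... | true  | no _     = sym (+-identityʳ _)
        ... | false | yes _    = sym (+-identityˡ _)
        ... | false | no _     = sym (+-identityʳ 0#)

    -- Transfers a sum between two systems. It serves for dropping members with zero coefficient,
    -- for extending a family by zero, and for systems that have the same members.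
    combination-⊆ : ∀ {𝒮 𝒯 : SetSystem n} {coeff coeff′} → 𝒯 ⊆ˢ 𝒮 →
      (∀ {S} → S ∈ˢ 𝒯 → coeff S ≈ coeff′ S) →
      (∀ {S} → S ∈ˢ 𝒮 → ¬ (S ∈ˢ 𝒯) → coeff S ≈ 0#) →
      ∀ i → combination 𝒮 coeff i ≈ combination 𝒯 coeff′ i
    combination-⊆ {𝒮} {𝒯} {coeff} {coeff′} 𝒯⊆𝒮 agree vanish i =
      sumSubsets-cong term
      where
      term : ∀ S → (if 𝒮 S then coeff S * χ S i else 0#) ≈
                   (if 𝒯 S then coeff′ S * χ S i else 0#)
      term S with 𝒮 S in S∈𝒮 | 𝒯 S in S∈𝒯
      ... | true  | true  = *-congʳ (agree S∈𝒯)
      ... | true  | false =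
        trans (*-congʳ (vanish S∈𝒮 λ S∈ → contradiction (≡.trans (≡.sym S∈) S∈𝒯) λ ()))
              (zeroˡ _)
      ... | false | true  = contradiction (≡.trans (≡.sym (𝒯⊆𝒮 S∈𝒯)) S∈𝒮) λ ()
      ... | false | false = ≈-refl

    -- Values of a family outside its system are arbitrary. Setting them to zero turns a combination
    -- over `𝒯` into one over any larger system, and makes conicity hold at every set.
    restrict : SetSystem n → (Subset n → Carrier) → Subset n → Carrier
    restrict 𝒯 coeff S = if 𝒯 S then coeff S else 0#

    restrict-∈ : ∀ (𝒯 : SetSystem n) coeff {S} → S ∈ˢ 𝒯 →
                 restrict 𝒯 coeff S ≈ coeff S
    restrict-∈ 𝒯 coeff S∈𝒯 rewrite S∈𝒯 = ≈-refl

    restrict-∉ : ∀ (𝒯 : SetSystem n) coeff {S} → ¬ (S ∈ˢ 𝒯) →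
                 restrict 𝒯 coeff S ≈ 0#
    restrict-∉ 𝒯 coeff {S} S∉𝒯 with 𝒯 S
    ... | true  = contradiction refl S∉𝒯
    ... | false = ≈-refl

    restrict-conic : ∀ (𝒯 : SetSystem n) coeff → Conic 𝒯 coeff →
                     ∀ S → 0# ≤ᶠ restrict 𝒯 coeff S
    restrict-conic 𝒯 coeff conic S with 𝒯 S in eq
    ... | true  = conic eq
    ... | false = ≤-refl

    combination-restrict : ∀ {𝒮 𝒯 : SetSystem n} {coeff} → 𝒯 ⊆ˢ 𝒮 → ∀ i →
      combination 𝒮 (restrict 𝒯 coeff) i ≈ combination 𝒯 coeff i
    combination-restrict {𝒮} {𝒯} {coeff} 𝒯⊆𝒮 =
      combination-⊆ 𝒯⊆𝒮 (restrict-∈ 𝒯 coeff) (λ _ → restrict-∉ 𝒯 coeff)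

    -- If `E` were a member, the term `μ E * χ E` of the balancing combination could be replaced by
    -- `μ E` times the representation of `χ E` by smaller sets. The system without `E` would then be
    -- balanced, against minimality.
    minBalanced⇒∉ : ∀ {M} {ℬ : SetSystem n} {E coeff} → MinBalanced M ℬ →
      E ≢ ⊥ → E ⊂ M → Conic (strictlyBelow ℬ E) coeff →
      combination (strictlyBelow ℬ E) coeff ≈[ M ] χ E → ¬ (E ∈ˢ ℬ)
    minBalanced⇒∉ {M} {ℬ} {E} {ν}
      ((nonTrivial , μ , conic , nonZero , balance) , minimal)
      E≢⊥ (E⊆M , _) conicν below≈E E∈ℬ =
      minimal 𝒯 (𝒯⊆ℬ , E , E∈ℬ , λ E∈𝒯 → proj₂ (∈-∖⁻ ℬ E∈𝒯) refl)
        ( NonTrivial-⊆ nonTrivial 𝒯⊆ℬ (proj₁ inhabited , below⊆𝒯 (proj₂ inhabited))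
        , coeff
        , (λ S∈𝒯 → +-nonneg (conic (𝒯⊆ℬ S∈𝒯)) (correction-nonneg _))
        -- The correction is non-negative, so it cannot cancel the non-zero `μ S`.
        , (λ S∈𝒯 Σ≈0 → nonZero (𝒯⊆ℬ S∈𝒯)
             (x+y≈0⇒x≈0 (conic (𝒯⊆ℬ S∈𝒯)) (correction-nonneg _) Σ≈0))
        , λ {i} → sums i
        )
      where
      𝒯 = ℬ ∖｛ E ｝
      below = strictlyBelow ℬ E

      𝒯⊆ℬ : 𝒯 ⊆ˢ ℬ
      𝒯⊆ℬ S∈𝒯 = proj₁ (∈-∖⁻ ℬ S∈𝒯)

      below⊆𝒯 : below ⊆ˢ 𝒯
      below⊆𝒯 S∈ = let S∈ℬ , S⊂E = ∈-below⁻ ℬ S∈ in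
        ∈-∖⁺ ℬ S∈ℬ (λ S≡E → ⊂-irref S≡E S⊂E)

      -- At a point of `E` the combination over `below` equals 1, so `below` cannot be empty.
      inhabited : ∃[ S ] S ∈ˢ below
      inhabited = let i , i∈E = ≢⊥⇒Nonempty E≢⊥ in
        combination≉0⇒nonempty below (λ Σ≈0 →
          0≉1 (trans (sym Σ≈0) (trans (below≈E (E⊆M i∈E)) (χ-∈ i∈E))))

      coeff : Subset n → Carrier
      coeff S = μ S + μ E * restrict below ν S

      correction-nonneg : ∀ S → 0# ≤ᶠ μ E * restrict below ν S
      correction-nonneg S = *-nonneg (conic E∈ℬ) (restrict-conic below ν conicν S)

      -- Removing `E` and adding it back gives a system with the same members as `ℬ`; the two
      -- inclusions are what `combination-⊆` needs.
      𝒯∪E⊆ℬ : (𝒯 ∪｛ E ｝) ⊆ˢ ℬ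
      𝒯∪E⊆ℬ S∈ with ∈-∪⁻ 𝒯 S∈
      ... | inj₁ S∈𝒯  = 𝒯⊆ℬ S∈𝒯
      ... | inj₂ refl = E∈ℬ

      ℬ⊆𝒯∪E : ℬ ⊆ˢ (𝒯 ∪｛ E ｝)
      ℬ⊆𝒯∪E {S} S∈ℬ = helper (S ≟ˢ E)
        where
        helper : Dec (S ≡ E) → S ∈ˢ 𝒯 ∪｛ E ｝
        helper (yes S≡E) = ∈-∪⁺ʳ 𝒯 S≡E
        helper (no S≢E)  = ∈-∪⁺ˡ 𝒯 (∈-∖⁺ ℬ S∈ℬ S≢E)

      sums : ∀ i → i ∈ M → combination 𝒯 coeff i ≈ χ M i
      sums i i∈M = begin
        combination 𝒯 coeff i
          ≈⟨ combination-+ 𝒯 μ _ i ⟩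
        combination 𝒯 μ i + combination 𝒯 (λ S → μ E * restrict below ν S) i
          ≈⟨ +-congˡ (combination-* 𝒯 (μ E) _ i) ⟩
        combination 𝒯 μ i + μ E * combination 𝒯 (restrict below ν) i
          ≈⟨ +-congˡ (*-congˡ (combination-restrict {𝒯} below⊆𝒯 i)) ⟩
        combination 𝒯 μ i + μ E * combination below ν i
          ≈⟨ +-congˡ (*-congˡ (below≈E i∈M)) ⟩
        combination 𝒯 μ i + μ E * χ E i
          ≈⟨ combination-∪ 𝒯 (λ E∈𝒯 → proj₂ (∈-∖⁻ ℬ E∈𝒯) refl) μ i ⟨
        combination (𝒯 ∪｛ E ｝) μ i
          ≈⟨ combination-⊆ 𝒯∪E⊆ℬ (λ _ → ≈-refl)
               (λ S∈ℬ S∉ → contradiction (ℬ⊆𝒯∪E S∈ℬ) S∉) i ⟨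
        combination ℬ μ i
          ≈⟨ balance i∈M ⟩
        χ M i ∎

    -- From exceptional sets to reducing sets and back.

    ¬balanced-⊤ : ∀ {M} {𝒮 : SetSystem n} → M ⊂ ⊤ →
                  (∀ {S} → S ∈ˢ 𝒮 → S ⊆ M) → ¬ Balanced ⊤ 𝒮
    ¬balanced-⊤ {𝒮 = 𝒮} (_ , i , _ , i∉M) 𝒮⊆M (_ , coeff , _ , _ , balance) =
      -- At a coordinate outside `M` the combination is 0, whereas `χ ⊤` is 1 there.
      0≉1 (trans (sym (combination-∉ 𝒮 (λ S∈𝒮 → i∉M ∘ 𝒮⊆M S∈𝒮)))
                 (trans (balance ∈⊤) (χ-∈ ∈⊤)))

    exceptional⇒reducible : ∀ {M} {ℬ : SetSystem n} {E} → M ⊂ ⊤ →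
      (∀ {S} → S ∈ˢ ℬ ∪｛ M ｝ → S ⊆ M) → ¬ (E ∈ˢ ℬ ∪｛ M ｝) → E ≢ ⊥ → E ≢ ⊤ →
      Exceptional E (ℬ ∪｛ M ｝ ∪｛ E ｝) → Reducible M ℬ
    exceptional⇒reducible {M} {ℬ} {E} (_ , k , _ , k∉M) 𝒮⊆M E∉𝒮 E≢⊥ E≢⊤ exceptional =
      -- The exceptional set is itself the reducing set; `y` is the inverse of `- coeff E` and
      -- normalises the multiple of `χ E` to `χ E`.
      E , E≢⊥ , E⊂M , (λ S → y * coeff S) ,
      (λ S∈ → *-nonneg 0≤y (conic (below⊆𝒮 S∈))) , λ {i} _ → sums i
      where
      open Exceptional exceptional
      𝒮 = ℬ ∪｛ M ｝
      below = strictlyBelow ℬ E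
      r = proj₁ constant
      coeffE≉0 = proj₂ negative

      conic : Conic 𝒮 coeff
      conic S∈𝒮 = nonneg (∈-∪⁺ˡ 𝒮 S∈𝒮) (λ { refl → E∉𝒮 S∈𝒮 })

      sum≈r : ∀ i → combination 𝒮 coeff i + coeff E * χ E i ≈ r
      sum≈r i = trans (sym (combination-∪ 𝒮 E∉𝒮 coeff i)) (proj₂ constant ∈⊤)

      sum-∉M : ∀ {i} → i ∉ M → coeff E * χ E i ≈ r
      sum-∉M {i} i∉M = begin
        coeff E * χ E i                          ≈⟨ +-identityˡ _ ⟨
        0# + coeff E * χ E i                     ≈⟨ +-congʳ (combination-∉ 𝒮 λ S∈ → i∉M ∘ 𝒮⊆M S∈) ⟨
        combination 𝒮 coeff i + coeff E * χ E i  ≈⟨ sum≈r i ⟩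
        r                                        ∎

      sum-∉E : ∀ {i} → i ∉ E → combination 𝒮 coeff i ≈ r
      sum-∉E {i} i∉E = begin
        combination 𝒮 coeff i                    ≈⟨ +-identityʳ _ ⟨
        combination 𝒮 coeff i + 0#               ≈⟨ +-congˡ (*χ-∉ (coeff E) i∉E) ⟨
        combination 𝒮 coeff i + coeff E * χ E i  ≈⟨ sum≈r i ⟩
        r                                        ∎

      r≈0 : r ≈ 0#
      -- The coordinate `k` lies outside `M`. If it is outside `E` too, every term there vanishes.
      -- If it is in `E`, it gives `r ≈ coeff E`, while a coordinate outside `E` shows that `r` is a
      -- sum of non-negative terms; this contradicts `coeff E < 0#`.
      r≈0 with k ∈? E
      ... | no k∉E  = trans (sym (sum-∉M k∉M)) (*χ-∉ _ k∉E)
      ... | yes k∈E = contradiction (antisym (proj₁ negative) 0≤coeffE) coeffE≉0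
        where
        0≤coeffE : 0# ≤ᶠ coeff E
        0≤coeffE = let j , j∉E = ≢⊤⇒∃∉ E≢⊤ in
          ≤-respʳ-≈ (trans (sum-∉E j∉E) (trans (sym (sum-∉M k∉M)) (*χ-∈ _ k∈E)))
            (combination-nonneg 𝒮 conic j)

      E⊂M : E ⊂ M
      E⊂M = ⊆∧≢⇒⊂
        -- A point of `E` outside `M` would give `coeff E ≈ r ≈ 0#`.
        (λ {i} i∈E → decidable-stable (i ∈? M) λ i∉M →
          coeffE≉0 (trans (sym (*χ-∈ _ i∈E)) (trans (sum-∉M i∉M) r≈0)))
        (λ E≡M → E∉𝒮 (∈-∪⁺ʳ ℬ E≡M))

      below⊆𝒮 : below ⊆ˢ 𝒮
      below⊆𝒮 S∈ = ∈-∪⁺ˡ ℬ (proj₁ (∈-below⁻ ℬ S∈))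

      -- Inclusion in `E` is strict because `E` is not a member, and `M` is ruled out because
      -- `E ⊂ M`.
      ⊆E⇒below : ∀ {S} → S ∈ˢ 𝒮 → S ⊆ E → S ∈ˢ below
      ⊆E⇒below S∈𝒮 S⊆E with ∈-∪⁻ ℬ S∈𝒮 | ⊆∧≢⇒⊂ S⊆E (λ { refl → E∉𝒮 S∈𝒮 })
      ... | inj₁ S∈ℬ  | S⊂E = ∈-below⁺ ℬ S∈ℬ S⊂E
      ... | inj₂ refl | M⊂E = contradiction M⊂E (⊂-asymmetric E⊂M)

      -- A member not counted in `below` has a point `j` outside `E`, where the conic combination
      -- equals `r ≈ 0#`.
      vanish : ∀ {S} → S ∈ˢ 𝒮 → ¬ (S ∈ˢ below) → coeff S ≈ 0#
      vanish {S} S∈𝒮 S∉ = let j , j∈S , j∉E = ⊈⇒∃∉ (S∉ ∘ ⊆E⇒below S∈𝒮) in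
        combination≈0⇒coeff≈0 𝒮 conic (trans (sum-∉E j∉E) r≈0) S∈𝒮 j∈S

      -coeffE≉0 : - coeff E ≉ 0#
      -coeffE≉0 -e≈0 = coeffE≉0 (trans (sym (-‿involutive (coeff E)))
                                       (trans (-‿cong -e≈0) -0#≈0#))

      y = proj₁ (inverse -coeffE≉0)

      -ey≈1 : - coeff E * y ≈ 1#
      -ey≈1 = proj₂ (inverse -coeffE≉0)

      0≤y : 0# ≤ᶠ y
      0≤y = inverse-nonneg (-‿nonneg (proj₁ negative)) -ey≈1

      sums : ∀ i → combination below (λ S → y * coeff S) i ≈ χ E i
      sums i = begin
        combination below (λ S → y * coeff S) i  ≈⟨ combination-* below y coeff i ⟩
        y * combination below coeff i            ≈⟨ *-congˡ (combination-⊆ below⊆𝒮 (λ _ → ≈-refl) vanish i) ⟨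
        y * combination 𝒮 coeff i                ≈⟨ *-congˡ (+-inverseˡ-unique _ _ (trans (sum≈r i) r≈0)) ⟩
        y * - (coeff E * χ E i)                  ≈⟨ *-congˡ (-‿distribˡ-* _ _) ⟩
        y * (- coeff E * χ E i)                  ≈⟨ *-assoc _ _ _ ⟨
        (y * - coeff E) * χ E i                  ≈⟨ *-congʳ (trans (*-comm _ _) -ey≈1) ⟩
        1# * χ E i                               ≈⟨ *-identityˡ _ ⟩
        χ E i                                    ∎

    -- The constant obtained is zero: the sets strictly below `E` add up to `χ E`, which coefficient
    -- `- 1#` at `E` cancels.
    reducing⇒exceptional : ∀ {M} {ℬ 𝒮 : SetSystem n} {E coeff} →
      ℬ ⊆ˢ 𝒮 → NonTrivial ⊤ 𝒮 → (∀ {S} → S ∈ˢ ℬ → S ⊆ M) →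
      ¬ (E ∈ˢ 𝒮) → E ≢ ⊥ → E ⊂ M → E ≢ ⊤ → Conic (strictlyBelow ℬ E) coeff →
      combination (strictlyBelow ℬ E) coeff ≈[ M ] χ E →
      Exceptional E (𝒮 ∪｛ E ｝)
    reducing⇒exceptional {M} {ℬ} {𝒮} {E} {ν}
      ℬ⊆𝒮 nonTrivial ℬ⊆M E∉𝒮 E≢⊥ (E⊆M , _) E≢⊤ conicν below≈E =
      record
      { nonTrivial = NonTrivial-∪ nonTrivial ⊆⊤ E≢⊥ E≢⊤
      ; member     = ∈-∪⁺ʳ 𝒮 refl
      ; coeff      = coeff
      ; constant   = 0# , λ {i} _ → sums i
      ; negative   = ≤-respˡ-≈ (sym coeff-E) (proj₁ -1<0) ,
                     λ e≈0 → proj₂ -1<0 (trans (sym coeff-E) e≈0)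
      ; nonneg     = λ {S} _ S≢E →
                     ≤-respʳ-≈ (sym (coeff-≢ S≢E)) (restrict-conic below ν conicν S)
      }
      where
      below = strictlyBelow ℬ E

      -- Members not strictly below `E` receive 0 through `restrict`, so they neither contribute nor
      -- violate non-negativity.
      coeff : Subset n → Carrier
      coeff S with S ≟ˢ E
      ... | yes _ = - 1#
      ... | no _  = restrict below ν S

      coeff-E : coeff E ≈ - 1#
      coeff-E with E ≟ˢ E
      ... | yes _  = ≈-refl
      ... | no E≢E = contradiction refl E≢E

      coeff-≢ : ∀ {S} → S ≢ E → coeff S ≈ restrict below ν S
      coeff-≢ {S} S≢E with S ≟ˢ E
      ... | yes S≡E = contradiction S≡E S≢E
      ... | no _    = ≈-refl

      ∈⇒≢E : ∀ {S} → S ∈ˢ 𝒮 → S ≢ E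
      ∈⇒≢E S∈𝒮 refl = E∉𝒮 S∈𝒮

      below⊆𝒮 : below ⊆ˢ 𝒮
      below⊆𝒮 S∈ = ℬ⊆𝒮 (proj₁ (∈-below⁻ ℬ S∈))

      -- The representation is given on `M` only; off `M` both sides vanish because `E` and all
      -- members of `ℬ` lie in `M`.
      below≈χE : ∀ i → combination below ν i ≈ χ E i
      below≈χE i with i ∈? M
      ... | yes i∈M = below≈E i∈M
      ... | no i∉M  =
        trans (combination-∉ below (λ S∈ → i∉M ∘ ℬ⊆M (proj₁ (∈-below⁻ ℬ S∈))))
              (sym (χ-∉ (i∉M ∘ E⊆M)))

      sums : ∀ i → combination (𝒮 ∪｛ E ｝) coeff i ≈ 0#
      sums i = begin
        combination (𝒮 ∪｛ E ｝) coeff i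
          ≈⟨ combination-∪ 𝒮 E∉𝒮 coeff i ⟩
        combination 𝒮 coeff i + coeff E * χ E i
          ≈⟨ +-cong
               (combination-⊆ below⊆𝒮
                 (λ S∈ → trans (coeff-≢ (∈⇒≢E (below⊆𝒮 S∈))) (restrict-∈ below ν S∈))
                 (λ S∈𝒮 S∉ → trans (coeff-≢ (∈⇒≢E S∈𝒮)) (restrict-∉ below ν S∉)) i)
               (trans (*-congʳ coeff-E) (-1*x≈-x _)) ⟩
        combination below ν i - χ E i
          ≈⟨ +-congʳ (below≈χE i) ⟩
        χ E i - χ E i
          ≈⟨ -‿inverseʳ _ ⟩
        0# ∎

lemma19 : ∀ {c ℓ₁ ℓ₂} (F : OrderedField c ℓ₁ ℓ₂) → let open SetSystems F in
    (n : ℕ) → 3 ≤ n →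
    (M : Subset n) → M ⊂ ⊤ → 2 ≤ ∣ M ∣ →
    (ℬ : SetSystem n) → MinBalanced M ℬ →
    MinSemiBalanced ⊤ (ℬ ∪｛ M ｝) →
    Irreducible M ℬ ⇔ Indecomposable (ℬ ∪｛ M ｝)
lemma19 F n _ M M⊂⊤ _ ℬ minBalanced minSemiBalanced = mk⇔
  -- Indecomposability includes purity, which holds since no member of `ℬ ∪｛ M ｝` reaches outside
  -- `M`.
  (λ (_ , ¬reducible) →
    (minSemiBalanced , ¬balanced-⊤ M⊂⊤ 𝒮⊆M) ,
    λ (E , E∉𝒮 , E≢⊥ , E≢⊤ , exceptional) →
      ¬reducible (exceptional⇒reducible M⊂⊤ 𝒮⊆M E∉𝒮 E≢⊥ E≢⊤ exceptional))
  (λ (_ , ¬decomposable) → minBalanced ,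
    λ (E , E≢⊥ , E⊂M , coeff , conic , below≈E) →
      -- A decomposing set must be new: minimality of `ℬ` keeps `E` out of `ℬ`, and strictness of
      -- `E ⊂ M` separates it from `M`.
      let E∉ℬ = minBalanced⇒∉ minBalanced E≢⊥ E⊂M conic below≈E
          E∉𝒮 = ∉𝒮 E∉ℬ E⊂M
          E≢⊤ = λ { refl → ⊂-asymmetric E⊂M M⊂⊤ }
      in ¬decomposable (E , E∉𝒮 , E≢⊥ , E≢⊤ ,
           reducing⇒exceptional (∈-∪⁺ˡ ℬ) nonTrivial𝒮 ℬ⊆M E∉𝒮 E≢⊥ E⊂M E≢⊤
             conic below≈E))
  where
  open Combinations F
  open SetSystems F

  ℬ⊆M : ∀ {S} → S ∈ˢ ℬ → S ⊆ M
  ℬ⊆M = NonTrivial.members⊆K (proj₁ (proj₁ minBalanced))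

  nonTrivial𝒮 : NonTrivial ⊤ (ℬ ∪｛ M ｝)
  nonTrivial𝒮 = proj₁ (proj₁ minSemiBalanced)

  𝒮⊆M : ∀ {S} → S ∈ˢ ℬ ∪｛ M ｝ → S ⊆ M
  𝒮⊆M S∈𝒮 with ∈-∪⁻ ℬ S∈𝒮
  ... | inj₁ S∈ℬ  = ℬ⊆M S∈ℬ
  ... | inj₂ refl = λ x∈M → x∈M

  ∉𝒮 : ∀ {E} → ¬ (E ∈ˢ ℬ) → E ⊂ M → ¬ (E ∈ˢ ℬ ∪｛ M ｝)
  ∉𝒮 E∉ℬ E⊂M E∈𝒮 with ∈-∪⁻ ℬ E∈𝒮
  ... | inj₁ E∈ℬ = E∉ℬ E∈ℬ
  ... | inj₂ E≡M = ⊂-irref E≡M E⊂M
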